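{- For every $k \geq 1$, all pattern sets of the form $[1342,\sigma(w)]$, where $w$ is a binary word of length $k$ with more than two runs, are Wilf equivalent.
   Context: A run of a binary word is a maximal block of consecutive equal letters. For a binary word $w=w_1\cdots w_{n-1}$, $\sigma(w)=\sigma_1\cdots\sigma_n$ is the permutation of $[n]$ where, for $k=1,\dots,n-1$, $\sigma_k$ is the minimum of the unused values of $[n]$ if $w_k=0$ and the maximum if $w_k=1$, and $\sigma_n$ is the remaining value. A circular permutation $[\pi]$ of size $n$ is the set of all rotations of a permutation $\pi$ of $[n]$; $[\sigma]$ contains $[\pi]$ if some rotation of $\sigma$ has a subsequence order-isomorphic to $\pi$, otherwise avoids it. $\mathrm{Av}_n[\pi_1,\dots,\pi_m]$ is the set of circular permutations of size $n$ avoiding each $[\pi_i]$; two pattern sets are Wilf equivalent if their $\mathrm{Av}_n$ have equal cardinality for every $n\ge 1$. -}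

module Defs where

open import Data.Bool using (Bool; true; false; _∧_; _∨_; not; if_then_else_)
open import Data.Nat using (ℕ; zero; suc; _+_; _∸_; _≤_; _<ᵇ_; _≡ᵇ_)
open import Relation.Binary.PropositionalEquality using (_≡_)
open import Data.List using (List; []; _∷_; _++_; [_]; map; concatMap; length; filterᵇ; deduplicateᵇ; upTo)
open import Data.Bool.ListAction using (and; or)
open import Data.Vec using (Vec; toList)

-- Permutations of [n] are lists of the values 1..n (one-line notation).

insertions : ℕ → List ℕ → List (List ℕ)
insertions x [] = [ [ x ] ]
insertions x (y ∷ ys) = (x ∷ y ∷ ys) ∷ map (y ∷_) (insertions x ys)

perms : ℕ → List (List ℕ)
perms zero = [ [] ]
perms (suc n) = concatMap (insertions (suc n)) (perms n)

rot : List ℕ → List ℕ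
rot [] = []
rot (x ∷ xs) = xs ++ [ x ]

rotIter : ℕ → List ℕ → List ℕ
rotIter zero π = π
rotIter (suc i) π = rotIter i (rot π)

-- All rotations of π (the elements of the circular permutation [π]).
rotations : List ℕ → List (List ℕ)
rotations π = map (λ i → rotIter i π) (upTo (length π))

subseqs : List ℕ → List (List ℕ)
subseqs [] = [ [] ]
subseqs (x ∷ xs) = map (x ∷_) (subseqs xs) ++ subseqs xs

eqListᵇ : List ℕ → List ℕ → Bool
eqListᵇ [] [] = true
eqListᵇ (x ∷ xs) (y ∷ ys) = (x ≡ᵇ y) ∧ eqListᵇ xs ys
eqListᵇ _ _ = false

eqBᵇ : Bool → Bool → Bool
eqBᵇ true b = b
eqBᵇ false b = not b

orderIsoᵇ : List ℕ → List ℕ → Bool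
orderIsoᵇ [] [] = true
orderIsoᵇ (x ∷ xs) (y ∷ ys) = compat xs ys ∧ orderIsoᵇ xs ys
  where
  compat : List ℕ → List ℕ → Bool
  compat [] [] = true
  compat (x' ∷ xs') (y' ∷ ys') =
    eqBᵇ (x <ᵇ x') (y <ᵇ y') ∧ eqBᵇ (x' <ᵇ x) (y' <ᵇ y) ∧ compat xs' ys'
  compat _ _ = false
orderIsoᵇ _ _ = false

containsᵇ : List ℕ → List ℕ → Bool
containsᵇ σ π = or (map (λ ρ → or (map (λ s → orderIsoᵇ s π) (subseqs ρ))) (rotations σ))

avoidsAllᵇ : List (List ℕ) → List ℕ → Bool
avoidsAllᵇ ps σ = and (map (λ π → not (containsᵇ σ π)) ps)

sameCircᵇ : List ℕ → List ℕ → Bool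
sameCircᵇ σ τ = or (map (λ ρ → eqListᵇ ρ τ) (rotations σ))

-- |Av_n[π₁,…,πₘ]|: number of circular permutations of size n avoiding all πᵢ,
-- i.e. the number of rotation classes among the avoiding permutations of [n]
-- (deduplicate keeps exactly one representative per class).
numAv : ℕ → List (List ℕ) → ℕ
numAv n ps = length (deduplicateᵇ sameCircᵇ (filterᵇ (avoidsAllᵇ ps) (perms n)))

WilfEquiv : List (List ℕ) → List (List ℕ) → Set
WilfEquiv ps qs = (n : ℕ) → 1 ≤ n → numAv n ps ≡ numAv n qs

-- σ(w) for a binary word w = w₁…w_{n-1} (true = 1, false = 0):
-- build lo hi w places the values lo..hi; a 0 takes the minimum unused value,
-- a 1 takes the maximum, and the last entry is the remaining value.
build : ℕ → ℕ → List Bool → List ℕ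
build lo hi [] = [ lo ]
build lo hi (false ∷ w) = lo ∷ build (suc lo) hi w
build lo hi (true ∷ w) = hi ∷ build lo (hi ∸ 1) w

sigma : List Bool → List ℕ
sigma w = build 1 (suc (length w)) w

changes : Bool → List Bool → ℕ
changes b [] = 0
changes b (c ∷ cs) = (if eqBᵇ b c then 0 else 1) + changes c cs

runs : List Bool → ℕ
runs [] = 0
runs (b ∷ bs) = suc (changes b bs)

p1342 : List ℕ
p1342 = 1 ∷ 3 ∷ 4 ∷ 2 ∷ []

{-# OPTIONS --safe #-}
-- Call a list extremal of shape w if each entry but the last is the minimum (letter 0) or
-- the maximum (letter 1) of the entries from it onwards; σ(w) is the only permutation of [n]
-- of shape w.  Inserting the maximum into an extremal list either creates a circular 1342 or
-- gives a rotation of an extremal list, so the circular permutations avoiding [1342] are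
-- exactly the [σ(w)].  If two extremal lists are proper rotations of each other, then one
-- head is the minimum and the other the maximum, and both words have at most two runs.  Hence
-- words with more than two runs represent distinct circular permutations, and, since deleting
-- entries of σ(w) deletes letters of w, [σ(w)] contains [σ(u)] iff u is a subword of w when u
-- has more than two runs.  Words with at most two runs never contain such a u, and the number
-- of words of given length without the subword u depends only on the length of u, by matching
-- the first letter of u greedily.
module Submission where

open import Defs
open import Data.Nat using (ℕ; _≤_; _<_)
open import Data.Bool using (Bool)
open import Data.Vec using (Vec; toList)
open import Data.List using (List; []; _∷_)
open import Relation.Binary.PropositionalEquality using (_≡_)

open import Data.Bool using (true; false; not; T; _∧_; _≟_)
open import Data.Bool.Properties using (T-∧; T-≡; not-involutive)
open import Data.Empty using (⊥; ⊥-elim)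
open import Data.List
  using (_++_; [_]; map; length; filter; filterᵇ; deduplicateᵇ; applyDownFrom; replicate)
open import Data.List.Membership.Propositional using (_∈_; find; lose)
open import Data.List.Membership.Propositional.Properties
open import Data.List.Properties
  using (++-assoc; ++-identityʳ; length-map; length-++; length-applyDownFrom; filter-++
        ; ∷-injective; ∷-injectiveʳ)
open import Data.List.Relation.Binary.Permutation.Propositional
  using (_↭_; ↭-refl; ↭-sym; ↭-trans; ↭-reflexive; prep; swap)
open import Data.List.Relation.Binary.Permutation.Propositional.Properties
  using (All-resp-↭; ↭-singleton-inv; ↭-empty-inv; ∈-resp-↭; ↭-length; drop-mid; drop-∷; ++-comm)
open import Data.List.Relation.Binary.Sublist.DecPropositional _≟_ using (_⊆?_)
open import Data.List.Relation.Binary.Sublist.Propositional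
  using (_⊆_; []; _∷_; _∷ʳ_; ⊆-refl; ⊆-trans; minimum)
open import Data.List.Relation.Binary.Sublist.Propositional.Properties
  using (All-resp-⊆; ++⁺; ++⁺ˡ)
open import Data.List.Relation.Unary.All as All using (All; []; _∷_)
import Data.List.Relation.Unary.All.Properties as AllP
open import Data.List.Relation.Unary.AllPairs using (AllPairs; []; _∷_)
import Data.List.Relation.Unary.AllPairs.Properties as AllPairsP
open import Data.List.Relation.Unary.Any as Any using (Any; here; there)
import Data.List.Relation.Unary.Any.Properties as AnyP
open import Data.Nat using (zero; suc; _+_; _∸_; _>_; _<ᵇ_; _≡ᵇ_; z≤n; s≤s; _<?_)
open import Data.Nat.Properties
  using (<ᵇ⇒<; m≤m+n; +-identityʳ; <⇒<ᵇ; <-asym; <-trans; ≤-trans; ≤-refl; ≤-antisym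
        ; ≤-reflexive; +-suc; +-comm; +-assoc; +-cancelʳ-≡; ≡ᵇ⇒≡; ≡⇒≡ᵇ; m≤n⇒m≤1+n; n≤1+n; m<m+n
        ; +-monoʳ-<; suc-injective; +-mono-≤)
open import Data.Product using (∃; ∃₂; _×_; _,_; proj₁; proj₂)
open import Data.Sum using (_⊎_; inj₁; inj₂)
open import Data.Unit using (tt)
open import Function using (_∘_; Equivalence)
open import Relation.Binary.PropositionalEquality
  using (refl; sym; trans; cong; cong₂; subst; module ≡-Reasoning)
open import Relation.Nullary using (¬_; yes; no; Dec; ¬?; contradiction)
open import Relation.Nullary.Decidable using (does; T?)
open import Data.List.Relation.Unary.Unique.Propositional using (Unique)
import Data.List.Relation.Unary.Unique.Propositional.Properties as UniqueP
open import Data.Vec.Properties using (length-toList)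

-- Lists of a given shape

Before : Bool → ℕ → ℕ → Set
Before false = _<_
Before true  = _>_

Before-asym : ∀ c {x y} → Before c x y → ¬ Before c y x
Before-asym false = <-asym
Before-asym true  = <-asym

Before-not : ∀ c {x y} → Before c x y → Before (not c) y x
Before-not false p = p
Before-not true  p = p

Before-excl : ∀ c d {x y} → Before c x y → Before d y x → d ≡ not c
Before-excl false false p q = contradiction q (<-asym p)
Before-excl false true  p q = refl
Before-excl true  false p q = refl
Before-excl true  true  p q = contradiction q (<-asym p)

Before-unique : ∀ c d {x y} → Before c x y → Before d x y → c ≡ d
Before-unique false false p q = refl
Before-unique false true  p q = contradiction q (<-asym p)
Before-unique true  false p q = contradiction q (<-asym p)
Before-unique true  true  p q = refl

infixr 5 _∷_

-- A letter is a direction for `Before`, so each argument for minima serves for maxima too. Only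
-- comparisons of entries occur, hence gaps in the values do no harm and shapes pass to sublists.
data Shaped : List Bool → List ℕ → Set where
  [-] : ∀ {x} → Shaped [] [ x ]
  _∷_ : ∀ {c w x xs} → All (Before c x) xs → Shaped w xs → Shaped (c ∷ w) (x ∷ xs)

Extremal : List ℕ → Set
Extremal xs = ∃ λ w → Shaped w xs

¬Shaped-[] : ∀ {w} → ¬ Shaped w []
¬Shaped-[] ()

Shaped-length : ∀ {w xs} → Shaped w xs → length xs ≡ suc (length w)
Shaped-length [-]     = refl
Shaped-length (_ ∷ s) = cong suc (Shaped-length s)

-- The tail of an entry with a letter is nonempty, and the comparison with the next entry already
-- decides that letter.
Shaped-unique : ∀ {v w xs} → Shaped v xs → Shaped w xs → v ≡ w
Shaped-unique [-] [-] = refl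
Shaped-unique [-] (_ ∷ ())
Shaped-unique (_ ∷ ()) [-]
Shaped-unique {c ∷ _} {d ∷ _} {_ ∷ _ ∷ _} (p ∷ s) (q ∷ t) =
  cong₂ _∷_ (Before-unique c d (All.head p) (All.head q)) (Shaped-unique s t)

Shaped-⊆ : ∀ {w x xs ys} → Shaped w ys → x ∷ xs ⊆ ys → ∃ λ v → v ⊆ w × Shaped v (x ∷ xs)
Shaped-⊆ [-] (refl ∷ [])   = [] , [] , [-]
Shaped-⊆ (_ ∷ s) (_ ∷ʳ sub) with v , v⊆w , t ← Shaped-⊆ s sub = v , _ ∷ʳ v⊆w , t
-- An entry that becomes the last one loses its letter.
Shaped-⊆ {xs = []} (_ ∷ _) (refl ∷ _) = [] , minimum _ , [-]
Shaped-⊆ {xs = _ ∷ _} (p ∷ s) (refl ∷ sub) with v , v⊆w , t ← Shaped-⊆ s sub =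
  _ ∷ v , refl ∷ v⊆w , All-resp-⊆ sub p ∷ t

-- Entries are kept or dropped together with their letters; the last entry, which has none, is
-- always kept.
Shaped-subword : ∀ {v w ys} → Shaped w ys → v ⊆ w → ∃ λ xs → xs ⊆ ys × Shaped v xs
Shaped-subword [-] [] = _ , ⊆-refl , [-]
Shaped-subword (_ ∷ s) (_ ∷ʳ sub) with xs , xs⊆ys , t ← Shaped-subword s sub =
  xs , _ ∷ʳ xs⊆ys , t
Shaped-subword (p ∷ s) (refl ∷ sub) with xs , xs⊆ys , t ← Shaped-subword s sub =
  _ ∷ xs , refl ∷ xs⊆ys , All-resp-⊆ xs⊆ys p ∷ t

-- If the heads differed, each would occur in the tail of the other list, so each would strictly
-- precede the other in direction `c`.
Shaped-↭⇒≡ : ∀ {w xs ys} → Shaped w xs → Shaped w ys → xs ↭ ys → xs ≡ ys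
Shaped-↭⇒≡ [-] [-] p with here refl ← ∈-resp-↭ p (here refl) = refl
Shaped-↭⇒≡ {c ∷ _} (p ∷ s) (q ∷ t) r with ∈-resp-↭ r (here refl) | ∈-resp-↭ (↭-sym r) (here refl)
... | here refl | _         = cong (_ ∷_) (Shaped-↭⇒≡ s t (drop-∷ r))
... | _         | here refl = cong (_ ∷_) (Shaped-↭⇒≡ s t (drop-∷ r))
... | there x∈  | there y∈  =
  contradiction (All.lookup q x∈) (Before-asym c (All.lookup p y∈))

-- The local function compat of orderIsoᵇ cannot be named outside Defs: the body of
-- compatible is the solution of the unification problem posed by orderIso-∷.
mutual
  compatible : ℕ → ℕ → List ℕ → List ℕ → Bool
  compatible = _

  orderIso-∷ : ∀ x y xs ys →
    orderIsoᵇ (x ∷ xs) (y ∷ ys) ≡ (compatible x y xs ys ∧ orderIsoᵇ xs ys)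
  orderIso-∷ _ _ _ _ = refl

-- Order isomorphism and shapes

T-∧⁻ : ∀ {b c} → T (b ∧ c) → T b × T c
T-∧⁻ = Equivalence.to T-∧

T-∧⁺ : ∀ {b c} → T b → T c → T (b ∧ c)
T-∧⁺ p q = Equivalence.from T-∧ (p , q)

eqBᵇ⇒≡ : ∀ b c → T (eqBᵇ b c) → b ≡ c
eqBᵇ⇒≡ true  true  _ = refl
eqBᵇ⇒≡ false false _ = refl

≡⇒eqBᵇ : ∀ {b c} → b ≡ c → T (eqBᵇ b c)
≡⇒eqBᵇ {true}  refl = tt
≡⇒eqBᵇ {false} refl = tt

<⇒<ᵇ≡true : ∀ {x y} → x < y → (x <ᵇ y) ≡ true
<⇒<ᵇ≡true p = Equivalence.to T-≡ (<⇒<ᵇ p)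

>⇒<ᵇ≡false : ∀ {x y} → x > y → (x <ᵇ y) ≡ false
>⇒<ᵇ≡false {x} {y} p with x <ᵇ y in eq
... | false = refl
... | true  = contradiction (<ᵇ⇒< x y (subst T (sym eq) tt)) (<-asym p)

same-order⁺ : ∀ c {x x' y y'} → Before c x x' → Before c y y' →
  (x <ᵇ x') ≡ (y <ᵇ y') × (x' <ᵇ x) ≡ (y' <ᵇ y)
same-order⁺ false p q =
  trans (<⇒<ᵇ≡true p) (sym (<⇒<ᵇ≡true q)) , trans (>⇒<ᵇ≡false p) (sym (>⇒<ᵇ≡false q))
same-order⁺ true  p q =
  trans (>⇒<ᵇ≡false p) (sym (>⇒<ᵇ≡false q)) , trans (<⇒<ᵇ≡true p) (sym (<⇒<ᵇ≡true q))

<ᵇ-reflects : ∀ {x x' y y'} → (x <ᵇ x') ≡ (y <ᵇ y') → y < y' → x < x'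
<ᵇ-reflects {x} {x'} eq q = <ᵇ⇒< x x' (subst T (sym eq) (<⇒<ᵇ q))

same-order⁻ : ∀ c {x x' y y'} → (x <ᵇ x') ≡ (y <ᵇ y') → (x' <ᵇ x) ≡ (y' <ᵇ y) →
  Before c y y' → Before c x x'
same-order⁻ false p q = <ᵇ-reflects p
same-order⁻ true  p q = <ᵇ-reflects q

compatible-∷⁻ : ∀ x y x' y' xs ys → T (compatible x y (x' ∷ xs) (y' ∷ ys)) →
  (x <ᵇ x') ≡ (y <ᵇ y') × (x' <ᵇ x) ≡ (y' <ᵇ y) × T (compatible x y xs ys)
compatible-∷⁻ x y x' y' xs ys t
  with p , t′ ← T-∧⁻ {eqBᵇ (x <ᵇ x') (y <ᵇ y')} t
  with q , r  ← T-∧⁻ {eqBᵇ (x' <ᵇ x) (y' <ᵇ y)} t′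
  = eqBᵇ⇒≡ _ _ p , eqBᵇ⇒≡ _ _ q , r

compatible-∷⁺ : ∀ x y x' y' xs ys →
  (x <ᵇ x') ≡ (y <ᵇ y') → (x' <ᵇ x) ≡ (y' <ᵇ y) → T (compatible x y xs ys) →
  T (compatible x y (x' ∷ xs) (y' ∷ ys))
compatible-∷⁺ x y x' y' xs ys p q r =
  T-∧⁺ {eqBᵇ (x <ᵇ x') (y <ᵇ y')} (≡⇒eqBᵇ p)
    (T-∧⁺ {eqBᵇ (x' <ᵇ x) (y' <ᵇ y)} (≡⇒eqBᵇ q) r)

compatible-Before⁻ : ∀ c x y xs ys → T (compatible x y xs ys) →
  All (Before c y) ys → All (Before c x) xs
compatible-Before⁻ c x y [] ys t a = []
compatible-Before⁻ c x y (x' ∷ xs) (y' ∷ ys) t (b ∷ a)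
  with p , q , r ← compatible-∷⁻ x y x' y' xs ys t
  = same-order⁻ c p q b ∷ compatible-Before⁻ c x y xs ys r a

compatible-Before⁺ : ∀ c x y xs ys → length xs ≡ length ys →
  All (Before c x) xs → All (Before c y) ys → T (compatible x y xs ys)
compatible-Before⁺ c x y [] [] _ [] [] = tt
compatible-Before⁺ c x y (x' ∷ xs) (y' ∷ ys) l (p ∷ ps) (q ∷ qs)
  with e , f ← same-order⁺ c p q
  = compatible-∷⁺ x y x' y' xs ys e f (compatible-Before⁺ c x y xs ys (suc-injective l) ps qs)

Shaped-orderIso⁻ : ∀ {w ys} xs → T (orderIsoᵇ xs ys) → Shaped w ys → Shaped w xs
Shaped-orderIso⁻ (x ∷ []) t [-] = [-]
Shaped-orderIso⁻ (x ∷ x' ∷ xs) () [-]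
Shaped-orderIso⁻ {c ∷ w} {y ∷ ys} (x ∷ xs) t (p ∷ s)
  with q , r ← T-∧⁻ {compatible x y xs ys} t
  = compatible-Before⁻ c x y xs ys q p ∷ Shaped-orderIso⁻ xs r s

-- The letter at the earlier of two positions decides how their entries compare, so the word fixes
-- the whole order type.
Shaped-orderIso⁺ : ∀ {w xs ys} → Shaped w xs → Shaped w ys → T (orderIsoᵇ xs ys)
Shaped-orderIso⁺ [-] [-] = tt
Shaped-orderIso⁺ {c ∷ w} {x ∷ xs} {y ∷ ys} (p ∷ s) (q ∷ t) =
  T-∧⁺ {compatible x y xs ys}
    (compatible-Before⁺ c x y xs ys (trans (Shaped-length s) (sym (Shaped-length t))) p q)
    (Shaped-orderIso⁺ s t)

-- Rotations and containment

infix 4 _↻_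

-- A single cut replaces the iteration of `rot`: symmetry is then immediate, and sublists can be
-- split along the cut.
_↻_ : List ℕ → List ℕ → Set
π ↻ ρ = ∃₂ λ xs ys → π ≡ xs ++ ys × ρ ≡ ys ++ xs

↻-refl : ∀ {π} → π ↻ π
↻-refl = [] , _ , refl , sym (++-identityʳ _)

↻-reflexive : ∀ {π ρ} → π ≡ ρ → π ↻ ρ
↻-reflexive refl = ↻-refl

↻-sym : ∀ {π ρ} → π ↻ ρ → ρ ↻ π
↻-sym (xs , ys , p , q) = ys , xs , q , p

-- Two cuts of one list: whichever comes first, `zs` is the stretch between them.
++-overlap : ∀ {A : Set} (xs ys : List A) {us vs} → xs ++ us ≡ ys ++ vs →
  (∃ λ zs → ys ≡ xs ++ zs × us ≡ zs ++ vs) ⊎ (∃ λ zs → xs ≡ ys ++ zs × vs ≡ zs ++ us)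
++-overlap [] ys eq = inj₁ (ys , refl , eq)
++-overlap (x ∷ xs) [] eq = inj₂ (x ∷ xs , refl , sym eq)
++-overlap (x ∷ xs) (y ∷ ys) eq with refl , eq′ ← ∷-injective eq | ++-overlap xs ys (∷-injectiveʳ eq)
... | inj₁ (zs , p , q) = inj₁ (zs , cong (x ∷_) p , q)
... | inj₂ (zs , p , q) = inj₂ (zs , cong (x ∷_) p , q)

↻-trans : ∀ {π ρ τ} → π ↻ ρ → ρ ↻ τ → π ↻ τ
↻-trans (xs , ys , refl , q) (us , vs , r , refl) with ++-overlap ys us (trans (sym q) r)
... | inj₁ (zs , refl , refl) = zs , vs ++ ys , ++-assoc zs vs ys , sym (++-assoc vs ys zs)
... | inj₂ (zs , refl , refl) = xs ++ us , zs , sym (++-assoc xs us zs) , ++-assoc zs xs us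

↻⇒↭ : ∀ {π ρ} → π ↻ ρ → π ↭ ρ
↻⇒↭ (xs , ys , refl , refl) = ++-comm xs ys

⊆-++⁻ : ∀ {A : Set} {zs : List A} xs {ys} → zs ⊆ xs ++ ys →
  ∃₂ λ us vs → zs ≡ us ++ vs × us ⊆ xs × vs ⊆ ys
⊆-++⁻ [] s = [] , _ , refl , [] , s
⊆-++⁻ (x ∷ xs) (_ ∷ʳ s) with us , vs , p , q , r ← ⊆-++⁻ xs s = us , vs , p , _ ∷ʳ q , r
⊆-++⁻ (x ∷ xs) (refl ∷ s) with us , vs , refl , q , r ← ⊆-++⁻ xs s =
  x ∷ us , vs , refl , refl ∷ q , r

++-⊆⁻ : ∀ {A : Set} us {vs zs : List A} → us ++ vs ⊆ zs →
  ∃₂ λ xs ys → zs ≡ xs ++ ys × us ⊆ xs × vs ⊆ ys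
++-⊆⁻ [] s = [] , _ , refl , [] , s
++-⊆⁻ (u ∷ us) (z ∷ʳ s) with xs , ys , refl , q , r ← ++-⊆⁻ (u ∷ us) s =
  z ∷ xs , ys , refl , z ∷ʳ q , r
++-⊆⁻ (u ∷ us) (refl ∷ s) with xs , ys , refl , q , r ← ++-⊆⁻ us s =
  u ∷ xs , ys , refl , refl ∷ q , r

-- The cut that rotates `π` also cuts `α`.
⊆-↻ : ∀ {α π ρ} → α ⊆ π → π ↻ ρ → ∃ λ β → α ↻ β × β ⊆ ρ
⊆-↻ s (xs , ys , refl , refl) with us , vs , p , q , r ← ⊆-++⁻ xs s =
  vs ++ us , (us , vs , p , refl) , ++⁺ r q

-- Conversely, a cut of the sublist extends to a cut of `π`.
↻-⊆ : ∀ {α β π} → α ⊆ π → α ↻ β → ∃ λ ρ → π ↻ ρ × β ⊆ ρ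
↻-⊆ s (us , vs , refl , refl) with xs , ys , p , q , r ← ++-⊆⁻ us s =
  ys ++ xs , (xs , ys , p , refl) , ++⁺ r q

-- The subsequence is taken before rotating, which makes containment monotone in π.
Contains : List ℕ → List ℕ → Set
Contains π τ = ∃₂ λ α β → α ⊆ π × α ↻ β × T (orderIsoᵇ β τ)

Contains-⊆ : ∀ {π ρ τ} → π ⊆ ρ → Contains π τ → Contains ρ τ
Contains-⊆ s (α , β , p , q , r) = α , β , ⊆-trans p s , q , r

Contains-↻ : ∀ {π ρ τ} → π ↻ ρ → Contains π τ → Contains ρ τ
Contains-↻ π↻ρ (α , β , p , q , r) with γ , α↻γ , γ⊆ρ ← ⊆-↻ p π↻ρ =
  γ , β , γ⊆ρ , ↻-trans (↻-sym α↻γ) q , r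

-- Runs of words, and rotations between extremal lists

changes-replicate : ∀ c k → changes c (replicate k c) ≡ 0
changes-replicate c     zero    = refl
changes-replicate false (suc k) = changes-replicate false k
changes-replicate true  (suc k) = changes-replicate true k

changes-two-blocks : ∀ c d k l → changes c (replicate k c ++ replicate l d) ≤ 1
changes-two-blocks c d zero zero = z≤n
changes-two-blocks false false zero (suc l) = changes-two-blocks false false zero l
changes-two-blocks false true zero (suc l) = s≤s (≤-reflexive (changes-replicate true l))
changes-two-blocks true false zero (suc l) = s≤s (≤-reflexive (changes-replicate false l))
changes-two-blocks true true zero (suc l) = changes-two-blocks true true zero l
changes-two-blocks false d (suc k) l = changes-two-blocks false d k l
changes-two-blocks true d (suc k) l = changes-two-blocks true d k l

runs-two-blocks : ∀ c d k l → runs (replicate k c ++ replicate l d) ≤ 2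
runs-two-blocks c d zero zero = z≤n
runs-two-blocks c d zero (suc l) =
  s≤s (≤-trans (≤-reflexive (changes-replicate d l)) z≤n)
runs-two-blocks c d (suc k) l = s≤s (changes-two-blocks c d k l)

-- The initial letter matters only for the comparison with the first letter of `w`.
changes-flip : ∀ b c w → changes b w ≤ suc (changes c w)
changes-flip b c [] = z≤n
changes-flip false false (d ∷ w) = n≤1+n _
changes-flip true true (d ∷ w) = n≤1+n _
changes-flip false true (false ∷ w) = m≤n⇒m≤1+n (n≤1+n _)
changes-flip false true (true ∷ w) = ≤-refl
changes-flip true false (false ∷ w) = ≤-refl
changes-flip true false (true ∷ w) = m≤n⇒m≤1+n (n≤1+n _)

changes-⊆ : ∀ b {v w} → v ⊆ w → changes b v ≤ changes b w
changes-⊆ b [] = z≤n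
changes-⊆ false (false ∷ʳ s) = changes-⊆ false s
-- The change counted at the skipped letter pays for restarting from that letter.
changes-⊆ false {v} (true ∷ʳ s) = ≤-trans (changes-flip false true v) (s≤s (changes-⊆ true s))
changes-⊆ true {v} (false ∷ʳ s) = ≤-trans (changes-flip true false v) (s≤s (changes-⊆ false s))
changes-⊆ true (true ∷ʳ s) = changes-⊆ true s
changes-⊆ b (_∷_ {x = c} refl s) = +-mono-≤ (≤-refl {x = _}) (changes-⊆ c s)

runs-∷ : ∀ b w → runs w ≤ runs (b ∷ w)
runs-∷ b [] = z≤n
runs-∷ false (false ∷ w) = ≤-refl
runs-∷ false (true ∷ w) = n≤1+n _
runs-∷ true (false ∷ w) = n≤1+n _
runs-∷ true (true ∷ w) = ≤-refl

runs-⊆ : ∀ {v w} → v ⊆ w → runs v ≤ runs w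
runs-⊆ [] = z≤n
runs-⊆ (b ∷ʳ s) = ≤-trans (runs-⊆ s) (runs-∷ b _)
runs-⊆ (_∷_ {x = b} refl s) = s≤s (changes-⊆ b s)

Shaped-∷⁻ : ∀ xs {w x y ys} → Shaped w (x ∷ xs ++ y ∷ ys) →
  ∃₂ λ c v → w ≡ c ∷ v × All (Before c x) (xs ++ y ∷ ys) × Shaped v (xs ++ y ∷ ys)
Shaped-∷⁻ []      (p ∷ s) = _ , _ , refl , p , s
Shaped-∷⁻ (_ ∷ _) (p ∷ s) = _ , _ , refl , p , s

-- Each entry of `xs` is compared with the later entry `y`, which forces its letter to be `not c`.
Shaped-block : ∀ c xs {w y ys} → Shaped w (xs ++ y ∷ ys) → All (Before c y) xs →
  ∃ λ v → w ≡ replicate (length xs) (not c) ++ v × Shaped v (y ∷ ys)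
Shaped-block c [] s [] = _ , refl , s
Shaped-block c (x ∷ xs) s₀ (q ∷ qs)
  with d , w , refl , p , s ← Shaped-∷⁻ xs s₀
  with v , refl , t ← Shaped-block c xs s qs
  = v , cong (_∷ _) (Before-excl c d q (All.lookup p (∈-++⁺ʳ xs (here refl)))) , t

-- Comparisons inside `xs` make the two shapes agree up to its last entry, and the comparison with
-- `y` makes each of these letters `c`.
Shaped-prefix : ∀ c {v w xs y ys} → Shaped v xs → Shaped w (xs ++ y ∷ ys) →
  All (λ x → Before c x y) xs → v ≡ replicate (length v) c
Shaped-prefix c [-] _ _ = refl
Shaped-prefix c {d ∷ v} {xs = x ∷ x' ∷ xs} (p ∷ s) (_∷_ {e} q t) (r ∷ rs) =
  cong₂ _∷_
    (trans (Before-unique d e (All.head p) (All.head q))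
      (Before-unique e c (All.lookup q (∈-++⁺ʳ (x' ∷ xs) (here refl))) r))
    (Shaped-prefix c s t rs)
Shaped-prefix c {d ∷ v} {xs = _ ∷ []} (_ ∷ ()) _ _

-- One of x, y is the minimum of all entries and the other is the maximum; seen from a
-- maximum (minimum) further on, every entry before it must be a minimum (maximum).
rotated-Shaped-runs : ∀ x xs y ys {v w} →
  Shaped v (x ∷ xs ++ y ∷ ys) → Shaped w (y ∷ ys ++ x ∷ xs) → runs w ≤ 2
rotated-Shaped-runs x xs y ys s t
  with c , _ , refl , p , _ ← Shaped-∷⁻ xs s
  with d , _ , refl , q , _ ← Shaped-∷⁻ ys t
  with refl ← Before-excl c d
    (All.lookup p (∈-++⁺ʳ xs (here refl))) (All.lookup q (∈-++⁺ʳ ys (here refl)))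
  with u , eq , r ← Shaped-block c (y ∷ ys) t (AllP.++⁻ʳ xs p)
  = subst (λ w → runs w ≤ 2) (sym (trans eq (cong (replicate (suc (length ys)) (not c) ++_) blocks)))
    (runs-two-blocks (not c) c (suc (length ys)) (length u))
  where
  x-first : All (λ z → Before c z y) (x ∷ xs)
  x-first = All.lookup p (∈-++⁺ʳ xs (here refl)) ∷
    All.map (λ b → subst (λ c → Before c _ _) (not-involutive c) (Before-not (not c) b))
      (All.tail (AllP.++⁻ʳ ys q))
  -- Here `u` is the shape of `x ∷ xs` at the end of one rotation; in the other rotation the same
  -- block is followed by `y`.
  blocks : u ≡ replicate (length u) c
  blocks = Shaped-prefix c r s x-first

Shaped-↻⇒≡ : ∀ {v w π ρ} → 2 < runs w → Shaped v π → Shaped w ρ → π ↻ ρ → π ≡ ρ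
Shaped-↻⇒≡ _ _ _ ([] , ys , refl , refl) = sym (++-identityʳ ys)
Shaped-↻⇒≡ _ _ _ (x ∷ xs , [] , refl , refl) = ++-identityʳ (x ∷ xs)
Shaped-↻⇒≡ r s t (x ∷ xs , y ∷ ys , refl , refl) =
  contradiction (≤-trans r (rotated-Shaped-runs x xs y ys s t)) λ { (s≤s (s≤s ())) }

-- The chosen sublist `α` is extremal, and its rotation `β` has shape `u`. More than two runs force
-- `α` and `β` to be equal, so `u` is the word left after deleting letters of `w`.
Contains⇒subword : ∀ {u w π τ} → 2 < runs u → Shaped u τ → Shaped w π → Contains π τ → u ⊆ w
Contains⇒subword r t s ([] , _ , _ , ([] , [] , refl , refl) , o) =
  ⊥-elim (¬Shaped-[] (Shaped-orderIso⁻ [] o t))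
Contains⇒subword r t s (_ ∷ _ , β , α⊆π , α↻β , o) with v , v⊆w , a ← Shaped-⊆ s α⊆π
  with b ← Shaped-orderIso⁻ β o t
  with refl ← Shaped-↻⇒≡ r a b α↻β
  with refl ← Shaped-unique a b
  = v⊆w

subword⇒Contains : ∀ {u w π τ} → Shaped u τ → Shaped w π → u ⊆ w → Contains π τ
subword⇒Contains t s sub with α , α⊆π , a ← Shaped-subword s sub =
  α , α , α⊆π , ↻-refl , Shaped-orderIso⁺ a t

-- Circular permutations avoiding 1342

1342-order⁺ : ∀ {p q r s} → p < s → s < q → q < r → T (orderIsoᵇ (p ∷ q ∷ r ∷ s ∷ []) p1342)
1342-order⁺ {p} {q} {r} {s} p<s s<q q<r
  rewrite <⇒<ᵇ≡true p<s | >⇒<ᵇ≡false p<s | <⇒<ᵇ≡true s<q | >⇒<ᵇ≡false s<q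
        | <⇒<ᵇ≡true q<r | >⇒<ᵇ≡false q<r
        | <⇒<ᵇ≡true (<-trans p<s s<q) | >⇒<ᵇ≡false (<-trans p<s s<q)
        | <⇒<ᵇ≡true (<-trans (<-trans p<s s<q) q<r) | >⇒<ᵇ≡false (<-trans (<-trans p<s s<q) q<r)
        | <⇒<ᵇ≡true (<-trans s<q q<r) | >⇒<ᵇ≡false (<-trans s<q q<r) = tt

orderIso-length : ∀ xs ys → T (orderIsoᵇ xs ys) → length xs ≡ length ys
orderIso-length [] [] _ = refl
orderIso-length (x ∷ xs) (y ∷ ys) t =
  cong suc (orderIso-length xs ys (proj₂ (T-∧⁻ {compatible x y xs ys} t)))

-- The lists `us` and `vs` only locate the second entry to be compared with the first.
orderIso⁻ : ∀ c {x y x' y'} us vs {xs ys} → length us ≡ length vs →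
  T (orderIsoᵇ (x ∷ us ++ x' ∷ xs) (y ∷ vs ++ y' ∷ ys)) → Before c y y' → Before c x x'
orderIso⁻ c {x} {y} us vs l t = entry us vs l (proj₁ (T-∧⁻ {compatible x y (us ++ _) (vs ++ _)} t))
  where
  entry : ∀ us vs {x' y' xs ys} → length us ≡ length vs →
    T (compatible x y (us ++ x' ∷ xs) (vs ++ y' ∷ ys)) → Before c y y' → Before c x x'
  entry [] [] {x'} {y'} {xs} {ys} _ t with p , q , _ ← compatible-∷⁻ x y x' y' xs ys t = same-order⁻ c p q
  entry (u ∷ us) (v ∷ vs) l t with _ , _ , r ← compatible-∷⁻ x y u v (us ++ _) (vs ++ _) t =
    entry us vs (suc-injective l) r

1342-order⁻ : ∀ β → T (orderIsoᵇ β p1342) → ∃₂ λ p q → ∃₂ λ r s →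
  β ≡ p ∷ q ∷ r ∷ s ∷ [] × p < s × s < q × q < r
1342-order⁻ β t with β | orderIso-length β p1342 t | t
... | p ∷ q ∷ r ∷ s ∷ [] | refl | t =
  p , q , r , s , refl
    -- Comparing the values 1 and 2, then 3 and 2, then 3 and 4 of the pattern puts all four entries
    -- in order.
    , orderIso⁻ false {p} {1} {s} {2} (q ∷ r ∷ []) (3 ∷ 4 ∷ []) {[]} {[]} refl t (s≤s (s≤s z≤n))
    , orderIso⁻ true {q} {3} {s} {2} (r ∷ []) (4 ∷ []) {[]} {[]} refl t′ (s≤s (s≤s (s≤s z≤n)))
    , orderIso⁻ false {q} {3} {r} {4} [] [] {s ∷ []} {2 ∷ []} refl t′ (s≤s (s≤s (s≤s (s≤s z≤n))))
  where
  t′ : T (orderIsoᵇ (q ∷ r ∷ s ∷ []) (3 ∷ 4 ∷ 2 ∷ []))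
  t′ = proj₂ (T-∧⁻ {compatible p 1 (q ∷ r ∷ s ∷ []) (3 ∷ 4 ∷ 2 ∷ [])} t)

¬Shaped-between : ∀ {w x y z xs} → Shaped w (x ∷ xs) → y ∈ xs → z ∈ xs → y < x → x < z → ⊥
¬Shaped-between {false ∷ _} (p ∷ _) y∈ _ y<x _ = <-asym y<x (All.lookup p y∈)
¬Shaped-between {true ∷ _}  (p ∷ _) _ z∈ _ x<z = <-asym x<z (All.lookup p z∈)

-- In each of the rotations 3421, 4213, 2134 and 1342 the first or second entry has both smaller and
-- larger entries after it, so none of them is extremal.
Shaped-avoids-1342 : ∀ {w π} → Shaped w π → ¬ Contains π p1342
Shaped-avoids-1342 sh ([] , _ , _ , ([] , [] , refl , refl) , ())
Shaped-avoids-1342 sh (α@(_ ∷ _) , β , α⊆π , (us , vs , α≡ , β≡) , o)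
  with _ , _ , sα ← Shaped-⊆ sh α⊆π
  with p , q , r , s , refl , p<s , s<q , q<r ← 1342-order⁻ β o
  = go us vs (subst (Shaped _) α≡ sα) (sym β≡)
  where
  go : ∀ us vs {w} → Shaped w (us ++ vs) → vs ++ us ≡ p ∷ q ∷ r ∷ s ∷ [] → ⊥
  go _ (_ ∷ []) sh refl = ¬Shaped-between sh (there (here refl)) (here refl) s<q q<r
  go _ (_ ∷ _ ∷ []) (_ ∷ sh) refl = ¬Shaped-between sh (here refl) (there (here refl)) p<s s<q
  go _ (_ ∷ _ ∷ _ ∷ []) sh refl = ¬Shaped-between sh (here refl) (there (here refl)) p<s s<q
  go [] (_ ∷ _ ∷ _ ∷ _ ∷ []) (_ ∷ sh) refl = ¬Shaped-between sh (there (here refl)) (here refl) s<q q<r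
  go _ [] (_ ∷ sh) refl = ¬Shaped-between sh (there (here refl)) (here refl) s<q q<r

1342⊆⇒Contains : ∀ {p q r s π} → p < s → s < q → q < r →
  p ∷ q ∷ r ∷ s ∷ [] ⊆ π → Contains π p1342
1342⊆⇒Contains p<s s<q q<r sub = _ , _ , sub , ↻-refl , 1342-order⁺ p<s s<q q<r

3421⊆⇒Contains : ∀ {p q r s π} → p < s → s < q → q < r →
  q ∷ r ∷ s ∷ p ∷ [] ⊆ π → Contains π p1342
3421⊆⇒Contains {p} {q} {r} {s} p<s s<q q<r sub =
  _ , _ , sub , (q ∷ r ∷ s ∷ [] , [ p ] , refl , refl) , 1342-order⁺ p<s s<q q<r

Monotone : Bool → List ℕ → Set
Monotone c = AllPairs (Before c)

AllBefore : Bool → List ℕ → List ℕ → Set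
AllBefore c xs ys = All (λ x → All (Before c x) ys) xs

Extremal-++ : ∀ c {xs ys} → Monotone c xs → AllBefore c xs ys → Extremal ys → Extremal (xs ++ ys)
Extremal-++ c [] [] e = e
Extremal-++ c (m ∷ ms) (p ∷ ps) e with w , s ← Extremal-++ c ms ps e =
  c ∷ w , AllP.++⁺ m p ∷ s

Monotone⇒Extremal : ∀ c {x xs} → Monotone c (x ∷ xs) → Extremal (x ∷ xs)
Monotone⇒Extremal c ([] ∷ []) = [] , [-]
Monotone⇒Extremal c (p@(_ ∷ _) ∷ m) with w , s ← Monotone⇒Extremal c m = c ∷ w , p ∷ s

All-swap : ∀ {R : ℕ → ℕ → Set} {xs ys} →
  All (λ x → All (R x) ys) xs → All (λ y → All (λ x → R x y) xs) ys
All-swap {ys = []} _ = []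
All-swap {ys = _ ∷ _} ps = All.map All.head ps ∷ All-swap (All.map All.tail ps)

-- In c … x … N … y with c < y < x < N the four entries form 1342, so no entry
-- before N is a maximum.
increasing-before : ∀ {c N w} xs {y ys} → ¬ Contains (c ∷ xs ++ N ∷ y ∷ ys) p1342 →
  All (c <_) (xs ++ y ∷ ys) → All (_< N) (xs ++ y ∷ ys) → Shaped w (xs ++ y ∷ ys) →
  Monotone false xs × AllBefore false xs (y ∷ ys) × Extremal (y ∷ ys)
increasing-before [] _ _ _ s = [] , [] , _ , s
increasing-before {c} {N} (x ∷ xs) {y} {ys} av (c<x ∷ c<) (x<N ∷ <N) sh
  with Shaped-∷⁻ xs sh
... | true , _ , refl , x> , s = contradiction
  (1342⊆⇒Contains (All.lookup c< y∈) (All.lookup x> y∈) x<N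
    (refl ∷ refl ∷ ++⁺ˡ xs (refl ∷ refl ∷ minimum ys))) av
  where
  y∈ : y ∈ xs ++ y ∷ ys
  y∈ = ∈-++⁺ʳ xs (here refl)
... | false , _ , refl , x< , s
  with m , b , e ← increasing-before xs (λ k → av (Contains-⊆ (refl ∷ (x ∷ʳ ⊆-refl)) k)) c< <N s
  = AllP.++⁻ˡ xs x< ∷ m , AllP.++⁻ʳ xs x< ∷ b , e

-- In x … N … y … z with z < y < x < N the four entries form 3421.
increasing-after : ∀ {x N w ys} → ¬ Contains (x ∷ N ∷ ys) p1342 → x < N →
  All (_< x) ys → Shaped w ys → Monotone false ys
increasing-after av x<N _ [-] = [] ∷ []
increasing-after av x<N (y<x ∷ <x) (_∷_ {false} y< s) =
  y< ∷ increasing-after (λ k → av (Contains-⊆ (refl ∷ refl ∷ (_ ∷ʳ ⊆-refl)) k)) x<N <x s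
increasing-after {ys = _ ∷ z ∷ zs} av x<N (y<x ∷ _) (_∷_ {true} (z<y ∷ _) s) =
  contradiction (3421⊆⇒Contains z<y y<x x<N (refl ∷ refl ∷ refl ∷ refl ∷ minimum zs)) av

-- Maxima are collected in `ds` until the first minimum before `N`, if there is one. That minimum
-- plays the part of `c` in `increasing-before`, so only minima follow it before `N`.
decreasing-then-increasing : ∀ {N w} xs {y ys} → ¬ Contains (xs ++ N ∷ y ∷ ys) p1342 →
  All (_< N) (xs ++ y ∷ ys) → Shaped w (xs ++ y ∷ ys) →
  ∃₂ λ ds is → xs ≡ ds ++ is × Monotone true ds × AllBefore true ds (is ++ y ∷ ys) ×
    Monotone false is × AllBefore false is (y ∷ ys) × Extremal (y ∷ ys)
decreasing-then-increasing [] _ _ s = [] , [] , refl , [] , [] , [] , [] , _ , s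
decreasing-then-increasing (x ∷ xs) av (x<N ∷ <N) sh with Shaped-∷⁻ xs sh
... | false , _ , refl , x< , s
  with m , b , e ← increasing-before xs av x< <N s
  = [] , x ∷ xs , refl , [] , [] , AllP.++⁻ˡ xs x< ∷ m , AllP.++⁻ʳ xs x< ∷ b , e
... | true , _ , refl , x> , s
  with ds , is , refl , m , b , rest ←
    decreasing-then-increasing xs (λ k → av (Contains-⊆ (x ∷ʳ ⊆-refl) k)) <N s
  with x>′ ← subst (All _) (++-assoc ds is _) x>
  = x ∷ ds , is , refl , AllP.++⁻ˡ ds x>′ ∷ m , AllP.++⁻ʳ ds x>′ ∷ b , rest

insert-max : ∀ {N w} xs ys → ¬ Contains (xs ++ N ∷ ys) p1342 →
  All (_< N) (xs ++ ys) → Shaped w (xs ++ ys) → ∃ λ ρ → xs ++ N ∷ ys ↻ ρ × Extremal ρ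
insert-max [] ys _ <N s = _ , ↻-refl , _ , _∷_ {c = true} <N s
-- A final `N` is rotated to the front, where it is a maximum.
insert-max {N} xs@(_ ∷ _) [] _ <N s =
  N ∷ xs , (xs , [ N ] , refl , refl) , _ , _∷_ {c = true}
    (subst (All _) (++-identityʳ xs) <N) (subst (Shaped _) (++-identityʳ xs) s)
insert-max {N} (x ∷ xs) ys@(_ ∷ _) av (x<N ∷ <N) sh with Shaped-∷⁻ xs sh
-- A leading minimum leaves only minima before `N`, so `N` can stay in place as a maximum.
... | false , _ , refl , x< , s with m , b , e ← increasing-before xs av x< <N s =
  _ , ↻-refl , Extremal-++ false (AllP.++⁻ˡ xs x< ∷ m)
    (All.zipWith (λ { (p , q) → p ∷ q }) (x<N ∷ AllP.++⁻ˡ xs <N , AllP.++⁻ʳ xs x< ∷ b))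
    (true ∷ proj₁ e , AllP.++⁻ʳ xs <N ∷ proj₂ e)
-- After a leading maximum, the decreasing block `x ∷ ds` is rotated to the end. It lies above `is`
-- and `ys`, both increasing, so the new list consists of minima `is`, the maximum `N`, minima `ys`
-- and a decreasing end.
... | true , _ , refl , x> , s
  with ds , is , refl , ds↓ , ds>is,ys , is↑ , is<ys , e ←
    decreasing-then-increasing xs (λ k → av (Contains-⊆ (x ∷ʳ ⊆-refl) k)) <N s
  with ys↑ ← increasing-after (λ k → av (Contains-⊆ (refl ∷ ++⁺ˡ xs ⊆-refl) k)) x<N
    (AllP.++⁻ʳ xs x>) (proj₂ e)
  = _ , (x ∷ ds , is ++ N ∷ ys , cong (x ∷_) (++-assoc ds is (N ∷ ys)) , refl) ,
    subst Extremal (sym (++-assoc is (N ∷ ys) (x ∷ ds)))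
      (Extremal-++ false is↑ is<rest
        (_ , _∷_ {c = true} (AllP.++⁺ (AllP.++⁻ʳ xs <N) (x<N ∷ AllP.++⁻ˡ ds (AllP.++⁻ˡ xs <N)))
          (proj₂ (Extremal-++ false ys↑ (AllP.++⁻ʳ is below)
            (Monotone⇒Extremal true (AllP.++⁻ˡ ds (AllP.++⁻ˡ xs x>) ∷ ds↓))))))
  where
  below : AllBefore false (is ++ ys) (x ∷ ds)
  below = All-swap (AllP.++⁺ (AllP.++⁻ʳ ds (AllP.++⁻ˡ xs x>)) (AllP.++⁻ʳ xs x>) ∷ ds>is,ys)
  is<rest : AllBefore false is ((N ∷ ys) ++ x ∷ ds)
  is<rest = All.tabulate λ i∈ → All.lookup <N (∈-++⁺ˡ (∈-++⁺ʳ ds i∈)) ∷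
    AllP.++⁺ (All.lookup is<ys i∈) (All.lookup below (∈-++⁺ˡ i∈))

-- Permutations of an interval, and the Boolean tests

-- Listed downwards, so that the largest value is at the head, in step with the recursion of `perms`
-- and with the letter 1 in `build`.
interval : ℕ → ℕ → List ℕ
interval lo n = applyDownFrom (lo +_) n

-- Splits off the minimum, as the letter 0 in `build` requires.
interval-∷ʳ : ∀ lo n → interval lo (suc n) ≡ interval (suc lo) n ++ [ lo ]
interval-∷ʳ lo zero    = cong [_] (+-identityʳ lo)
interval-∷ʳ lo (suc n) = cong₂ _∷_ (+-suc lo n) (interval-∷ʳ lo n)

build-↭ : ∀ lo {hi} w → hi ≡ lo + length w → build lo hi w ↭ interval lo (suc (length w))
build-↭ lo [] _ = ↭-reflexive (cong [_] (sym (+-identityʳ lo)))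
build-↭ lo (false ∷ w) p =
  ↭-trans (prep lo (build-↭ (suc lo) w (trans p (+-suc lo (length w)))))
    (↭-trans (↭-sym (++-comm (interval (suc lo) (suc (length w))) [ lo ]))
      (↭-reflexive (sym (interval-∷ʳ lo (suc (length w))))))
build-↭ lo (true ∷ w) refl = prep _ (build-↭ lo w (cong (_∸ 1) (+-suc lo (length w))))

interval-bounds : ∀ lo n → All (λ v → lo ≤ v × v < lo + n) (interval lo n)
interval-bounds lo n = AllP.applyDownFrom⁺₁ (lo +_) n λ {i} i<n → m≤m+n lo i , +-monoʳ-< lo i<n

build-Shaped : ∀ lo {hi} w → hi ≡ lo + length w → Shaped w (build lo hi w)
build-Shaped lo [] _ = [-]
build-Shaped lo (false ∷ w) p =
  All.map proj₁ (All-resp-↭ (↭-sym (build-↭ (suc lo) w q)) (interval-bounds (suc lo) _)) ∷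
  build-Shaped (suc lo) w q
  where q = trans p (+-suc lo (length w))
build-Shaped lo (true ∷ w) refl =
  All.map proj₂ (All-resp-↭ (↭-sym (build-↭ lo w q)) (interval-bounds lo _)) ∷
  build-Shaped lo w q
  where q = cong (_∸ 1) (+-suc lo (length w))

sigma-Shaped : ∀ w → Shaped w (sigma w)
sigma-Shaped w = build-Shaped 1 w refl

sigma-↭ : ∀ w → sigma w ↭ interval 1 (suc (length w))
sigma-↭ w = build-↭ 1 w refl

-- The place of `N` and the cut of the rotation are two cuts of the same list; in either order `N`
-- is carried along.
insert-↻ : ∀ N xs {ys ρ} → xs ++ ys ↻ ρ →
  ∃₂ λ us vs → ρ ≡ us ++ vs × xs ++ N ∷ ys ↻ us ++ N ∷ vs
insert-↻ N xs {ys} (as , bs , p , refl) with ++-overlap xs as p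
... | inj₁ (zs , refl , refl) = bs ++ xs , zs , sym (++-assoc bs xs zs) ,
  xs ++ N ∷ zs , bs , sym (++-assoc xs (N ∷ zs) bs) , ++-assoc bs xs (N ∷ zs)
... | inj₂ (zs , refl , refl) = zs , ys ++ as , ++-assoc zs ys as ,
  as , zs ++ N ∷ ys , ++-assoc as zs (N ∷ ys) , sym (++-assoc zs (N ∷ ys) as)

-- Induction by removing the maximum: the rest has an extremal rotation, and rotating with the
-- maximum in place reduces the claim to `insert-max`.
avoids-1342⇒Extremal : ∀ n {π} → π ↭ interval 1 (suc n) → ¬ Contains π p1342 →
  ∃ λ ρ → π ↻ ρ × Extremal ρ
avoids-1342⇒Extremal zero p _ with refl ← ↭-singleton-inv p = _ , ↻-refl , [] , [-]
avoids-1342⇒Extremal (suc n) p av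
  with xs , ys , refl ← ∈-∃++ (∈-resp-↭ (↭-sym p) (here refl))
  with q ← drop-mid xs [] p
  with ρ , xs++ys↻ρ , w , s ← avoids-1342⇒Extremal n q
    (λ k → av (Contains-⊆ (++⁺ (⊆-refl {x = xs}) (_ ∷ʳ ⊆-refl)) k))
  with us , vs , refl , π↻ ← insert-↻ (suc (suc n)) xs xs++ys↻ρ
  with τ , ↻τ , e ← insert-max us vs (λ k → av (Contains-↻ (↻-sym π↻) k))
    (All.map proj₂ (All-resp-↭ (↭-trans (↭-sym q) (↻⇒↭ xs++ys↻ρ)) (interval-bounds 1 (suc n)))) s
  = τ , ↻-trans π↻ ↻τ , e

avoids-1342⇒sigma : ∀ n {π} → π ↭ interval 1 (suc n) → ¬ Contains π p1342 →
  ∃ λ w → length w ≡ n × π ↻ sigma w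
avoids-1342⇒sigma n {π} p av with ρ , π↻ρ , w , s ← avoids-1342⇒Extremal n p av
  = w , l , subst (π ↻_) (Shaped-↭⇒≡ s (sigma-Shaped w) ρ↭) π↻ρ
  where
  l : length w ≡ n
  l = suc-injective (trans (sym (Shaped-length s))
    (trans (↭-length (↭-trans (↭-sym (↻⇒↭ π↻ρ)) p)) (length-applyDownFrom (1 +_) (suc n))))
  ρ↭ : ρ ↭ sigma w
  ρ↭ = ↭-trans (↭-sym (↻⇒↭ π↻ρ)) (↭-trans p
    (↭-sym (subst (λ n → sigma w ↭ interval 1 (suc n)) l (sigma-↭ w))))

insertions⇒↭ : ∀ {π} x ys → π ∈ insertions x ys → π ↭ x ∷ ys
insertions⇒↭ x [] (here refl) = ↭-refl
insertions⇒↭ x (y ∷ ys) (here refl) = ↭-refl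
insertions⇒↭ x (y ∷ ys) (there π∈) with ρ , ρ∈ , refl ← ∈-map⁻ (y ∷_) π∈ =
  ↭-trans (prep y (insertions⇒↭ x ys ρ∈)) (swap y x ↭-refl)

∈-insertions : ∀ x ys zs → ys ++ x ∷ zs ∈ insertions x (ys ++ zs)
∈-insertions x [] []       = here refl
∈-insertions x [] (z ∷ zs) = here refl
∈-insertions x (y ∷ ys) zs = there (∈-map⁺ (y ∷_) (∈-insertions x ys zs))

perms⇒↭ : ∀ n {π} → π ∈ perms n → π ↭ interval 1 n
perms⇒↭ zero (here refl) = ↭-refl
perms⇒↭ (suc n) π∈ with ρ , ρ∈ , π∈ρ ← find (∈-concatMap⁻ (insertions (suc n)) {xs = perms n} π∈) =
  ↭-trans (insertions⇒↭ (suc n) ρ π∈ρ) (prep _ (perms⇒↭ n ρ∈))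

↭⇒perms : ∀ n {π} → π ↭ interval 1 n → π ∈ perms n
↭⇒perms zero p with refl ← ↭-empty-inv p = here refl
↭⇒perms (suc n) p with xs , ys , refl ← ∈-∃++ (∈-resp-↭ (↭-sym p) (here refl)) =
  ∈-concatMap⁺ (insertions (suc n)) {xs = perms n}
    (lose (↭⇒perms n (drop-mid xs [] p)) (∈-insertions (suc n) xs ys))

rot-↻ : ∀ π → π ↻ rot π
rot-↻ []       = ↻-refl
rot-↻ (x ∷ xs) = [ x ] , xs , refl , refl

rotIter-↻ : ∀ i π → π ↻ rotIter i π
rotIter-↻ zero    π = ↻-refl
rotIter-↻ (suc i) π = ↻-trans (rot-↻ π) (rotIter-↻ i (rot π))

rotIter-++ : ∀ xs ys → rotIter (length xs) (xs ++ ys) ≡ ys ++ xs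
rotIter-++ [] ys = sym (++-identityʳ ys)
rotIter-++ (x ∷ xs) ys = begin
  rotIter (length xs) ((xs ++ ys) ++ [ x ]) ≡⟨ cong (rotIter (length xs)) (++-assoc xs ys [ x ]) ⟩
  rotIter (length xs) (xs ++ ys ++ [ x ])   ≡⟨ rotIter-++ xs (ys ++ [ x ]) ⟩
  (ys ++ [ x ]) ++ xs                       ≡⟨ ++-assoc ys [ x ] xs ⟩
  ys ++ x ∷ xs                              ∎
  where open ≡-Reasoning

∈-rotations⁻ : ∀ {π ρ} → ρ ∈ rotations π → π ↻ ρ
∈-rotations⁻ {π} ρ∈ with i , _ , refl ← ∈-map⁻ (λ i → rotIter i π) ρ∈ = rotIter-↻ i π

-- The empty list is excluded because `rotations []` has no element, although `[] ↻ []`.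
∈-rotations⁺ : ∀ {π ρ} → 0 < length π → π ↻ ρ → ρ ∈ rotations π
-- For a cut at the end, `length xs` iterations are out of range; iteration 0 gives the same list.
∈-rotations⁺ 0<l (xs , [] , refl , refl) =
  subst (_∈ rotations (xs ++ [])) (++-identityʳ xs)
    (∈-map⁺ (λ i → rotIter i (xs ++ [])) (∈-upTo⁺ 0<l))
∈-rotations⁺ _ (xs , ys@(_ ∷ _) , refl , refl) =
  subst (_∈ rotations (xs ++ ys)) (rotIter-++ xs ys)
    (∈-map⁺ (λ i → rotIter i (xs ++ ys)) (∈-upTo⁺
      (subst (length xs <_) (sym (length-++ xs)) (m<m+n (length xs) (s≤s z≤n)))))

∈-subseqs⁻ : ∀ {s} xs → s ∈ subseqs xs → s ⊆ xs
∈-subseqs⁻ [] (here refl) = []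
∈-subseqs⁻ (x ∷ xs) s∈ with ∈-++⁻ (map (x ∷_) (subseqs xs)) s∈
... | inj₁ s∈′ with _ , t∈ , refl ← ∈-map⁻ (x ∷_) s∈′ = refl ∷ ∈-subseqs⁻ xs t∈
... | inj₂ s∈′ = x ∷ʳ ∈-subseqs⁻ xs s∈′

∈-subseqs⁺ : ∀ {s xs} → s ⊆ xs → s ∈ subseqs xs
∈-subseqs⁺ [] = here refl
∈-subseqs⁺ (x ∷ʳ sub) = ∈-++⁺ʳ _ (∈-subseqs⁺ sub)
∈-subseqs⁺ (refl ∷ sub) = ∈-++⁺ˡ (∈-map⁺ (_ ∷_) (∈-subseqs⁺ sub))

contains⇒Contains : ∀ π τ → T (containsᵇ π τ) → Contains π τ
contains⇒Contains π τ t
  with ρ , ρ∈ , u ← find (AnyP.any⁻ _ (rotations π) t)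
  with β , β∈ , o ← find (AnyP.any⁻ _ (subseqs ρ) u)
  with α , β↻α , α⊆π ← ⊆-↻ (∈-subseqs⁻ ρ β∈) (↻-sym (∈-rotations⁻ ρ∈))
  = α , β , α⊆π , ↻-sym β↻α , o

Contains⇒contains : ∀ {π τ} → 0 < length π → Contains π τ → T (containsᵇ π τ)
Contains⇒contains 0<l (α , β , α⊆π , α↻β , o) with ρ , π↻ρ , β⊆ρ ← ↻-⊆ α⊆π α↻β =
  AnyP.any⁺ _ (lose (∈-rotations⁺ 0<l π↻ρ) (AnyP.any⁺ _ (lose (∈-subseqs⁺ β⊆ρ) o)))

eqList⇒≡ : ∀ xs ys → T (eqListᵇ xs ys) → xs ≡ ys
eqList⇒≡ [] [] _ = refl
eqList⇒≡ (x ∷ xs) (y ∷ ys) t with p , q ← T-∧⁻ {x ≡ᵇ y} t =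
  cong₂ _∷_ (≡ᵇ⇒≡ x y p) (eqList⇒≡ xs ys q)

eqList-refl : ∀ xs → T (eqListᵇ xs xs)
eqList-refl []       = tt
eqList-refl (x ∷ xs) = T-∧⁺ {x ≡ᵇ x} (≡⇒≡ᵇ x x refl) (eqList-refl xs)

sameCirc⇒↻ : ∀ {π τ} → T (sameCircᵇ π τ) → π ↻ τ
sameCirc⇒↻ {π} {τ} t with ρ , ρ∈ , u ← find (AnyP.any⁻ (λ ρ → eqListᵇ ρ τ) (rotations π) t)
  with refl ← eqList⇒≡ ρ τ u = ∈-rotations⁻ ρ∈

↻⇒sameCirc : ∀ {π τ} → 0 < length π → π ↻ τ → T (sameCircᵇ π τ)
↻⇒sameCirc {τ = τ} 0<l π↻τ = AnyP.any⁺ (λ ρ → eqListᵇ ρ τ)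
  (lose (∈-rotations⁺ 0<l π↻τ) (eqList-refl τ))

T-not⁻ : ∀ b → T (not b) → ¬ T b
T-not⁻ false _ ()

T-not⁺ : ∀ b → ¬ T b → T (not b)
T-not⁺ false _ = tt
T-not⁺ true  k = k tt

avoids⇒¬Contains : ∀ {π} τ υ → 0 < length π → T (avoidsAllᵇ (τ ∷ υ ∷ []) π) →
  ¬ Contains π τ × ¬ Contains π υ
avoids⇒¬Contains {π} τ υ 0<l t
  with p , t′ ← T-∧⁻ {not (containsᵇ π τ)} t
  with q , _ ← T-∧⁻ {not (containsᵇ π υ)} t′
  = (λ k → T-not⁻ _ p (Contains⇒contains 0<l k)) , (λ k → T-not⁻ _ q (Contains⇒contains 0<l k))

¬Contains⇒avoids : ∀ {π} τ υ → ¬ Contains π τ → ¬ Contains π υ → T (avoidsAllᵇ (τ ∷ υ ∷ []) π)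
¬Contains⇒avoids {π} τ υ p q =
  T-∧⁺ (T-not⁺ _ (λ t → p (contains⇒Contains π τ t)))
    (T-∧⁺ (T-not⁺ _ (λ t → q (contains⇒Contains π υ t))) tt)

-- Counting

PairwiseDistinct : List (List ℕ) → Set
PairwiseDistinct = AllPairs λ π ρ → ¬ π ↻ ρ

-- Pigeonhole: the entry of `ρs` matched with `π` is deleted, and the other members of `πs`, lying
-- in other classes, still find their matches.
classes-≤ : ∀ {πs ρs} → PairwiseDistinct πs → (∀ {π} → π ∈ πs → Any (π ↻_) ρs) →
  length πs ≤ length ρs
classes-≤ [] _ = z≤n
classes-≤ {π ∷ πs} (π≁ ∷ d) f with ρ , ρ∈ , π↻ρ ← find (f (here refl))
  with as , bs , refl ← ∈-∃++ ρ∈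
  = ≤-trans (s≤s (classes-≤ d λ τ∈ → without (All.lookup π≁ τ∈) (f (there τ∈))))
      (≤-reflexive (sym (trans (length-++ as) (trans (+-suc (length as) (length bs))
        (cong suc (sym (length-++ as)))))))
  where
  without : ∀ {τ} → ¬ π ↻ τ → Any (τ ↻_) (as ++ ρ ∷ bs) → Any (τ ↻_) (as ++ bs)
  without π≁τ a with AnyP.++⁻ as a
  ... | inj₁ p         = AnyP.++⁺ˡ p
  ... | inj₂ (here p)  = contradiction (↻-trans π↻ρ (↻-sym p)) π≁τ
  ... | inj₂ (there p) = AnyP.++⁺ʳ as p

NonEmpty : List ℕ → Set
NonEmpty π = 0 < length π

circles : List (List ℕ) → List (List ℕ)
circles = deduplicateᵇ sameCircᵇ

circles-distinct : ∀ {πs} → All NonEmpty πs → PairwiseDistinct (circles πs)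
circles-distinct [] = []
circles-distinct {π ∷ πs} (ne ∷ nes) =
  All.map (λ k r → k (↻⇒sameCirc ne r)) (AllP.all-filter (λ ρ → ¬? (T? (sameCircᵇ π ρ))) (circles πs)) ∷
  AllPairsP.filter⁺ (λ ρ → ¬? (T? (sameCircᵇ π ρ))) (circles-distinct nes)

circles-cover : ∀ {π πs} → π ∈ πs → Any (π ↻_) (circles πs)
circles-cover {π} π∈ = AnyP.deduplicate⁺ (λ ρ τ → T? (sameCircᵇ ρ τ))
  (λ r p → ↻-trans p (↻-sym (sameCirc⇒↻ r))) (Any.map ↻-reflexive π∈)

∈-circles⁻ : ∀ {π πs} → π ∈ circles πs → π ∈ πs
∈-circles⁻ {πs = πs} = ∈-deduplicate⁻ (λ ρ τ → T? (sameCircᵇ ρ τ)) πs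

words : ℕ → List (List Bool)
words zero    = [ [] ]
words (suc n) = map (false ∷_) (words n) ++ map (true ∷_) (words n)

∈-words⁺ : ∀ w → w ∈ words (length w)
∈-words⁺ []          = here refl
∈-words⁺ (false ∷ w) = ∈-++⁺ˡ (∈-map⁺ (false ∷_) (∈-words⁺ w))
∈-words⁺ (true ∷ w)  = ∈-++⁺ʳ _ (∈-map⁺ (true ∷_) (∈-words⁺ w))

∈-words⁻ : ∀ n {w} → w ∈ words n → length w ≡ n
∈-words⁻ zero (here refl) = refl
∈-words⁻ (suc n) w∈ with ∈-++⁻ (map (false ∷_) (words n)) w∈
... | inj₁ p with _ , v∈ , refl ← ∈-map⁻ (false ∷_) p = cong suc (∈-words⁻ n v∈)
... | inj₂ p with _ , v∈ , refl ← ∈-map⁻ (true ∷_) p = cong suc (∈-words⁻ n v∈)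

words-unique : ∀ n → Unique (words n)
words-unique zero = [] ∷ []
words-unique (suc n) = UniqueP.++⁺ (UniqueP.map⁺ (proj₂ ∘ ∷-injective) (words-unique n))
  (UniqueP.map⁺ (proj₂ ∘ ∷-injective) (words-unique n)) λ { (p , q) → disjoint p q }
  where
  disjoint : ∀ {w} → w ∈ map (false ∷_) (words n) → w ∈ map (true ∷_) (words n) → ⊥
  disjoint p q with ∈-map⁻ (false ∷_) p | ∈-map⁻ (true ∷_) q
  ... | _ , _ , refl | _ , _ , ()

-- Words without a given subword

avoids? : ∀ u w → Dec (¬ u ⊆ w)
avoids? u w = ¬? (u ⊆? w)

avoiding : List Bool → ℕ → List (List Bool)
avoiding u n = filter (avoids? u) (words n)

length-filter-map : ∀ {A B : Set} {P : B → Set} {Q : A → Set}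
  (P? : ∀ y → Dec (P y)) (Q? : ∀ x → Dec (Q x)) (f : A → B) →
  (∀ x → does (P? (f x)) ≡ does (Q? x)) →
  ∀ xs → length (filter P? (map f xs)) ≡ length (filter Q? xs)
length-filter-map P? Q? f eq [] = refl
length-filter-map P? Q? f eq (x ∷ xs) with does (P? (f x)) | does (Q? x) | eq x
... | false | _ | refl = length-filter-map P? Q? f eq xs
... | true  | _ | refl = cong suc (length-filter-map P? Q? f eq xs)

-- Greedy matching: a word starting with `c` uses it up and must then avoid `u`, while after the
-- other letter `c ∷ u` is still to be avoided.
length-avoiding-suc : ∀ c u n → length (avoiding (c ∷ u) (suc n)) ≡
  length (avoiding u n) + length (avoiding (c ∷ u) n)
length-avoiding-suc c u n = begin
  length (avoiding (c ∷ u) (suc n))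
    ≡⟨ cong length (filter-++ cu? (map (false ∷_) ws) (map (true ∷_) ws)) ⟩
  length (filter cu? (map (false ∷_) ws) ++ filter cu? (map (true ∷_) ws))
    ≡⟨ length-++ (filter cu? (map (false ∷_) ws)) ⟩
  length (filter cu? (map (false ∷_) ws)) + length (filter cu? (map (true ∷_) ws))
    ≡⟨ split c ⟩
  length (avoiding u n) + length (avoiding (c ∷ u) n) ∎
  where
  open ≡-Reasoning
  ws = words n
  cu? = avoids? (c ∷ u)
  split : ∀ c → length (filter (avoids? (c ∷ u)) (map (false ∷_) ws)) +
      length (filter (avoids? (c ∷ u)) (map (true ∷_) ws)) ≡
    length (avoiding u n) + length (avoiding (c ∷ u) n)
  split false = cong₂ _+_
    -- The decision procedure `_⊆?_` is itself greedy, so the two decisions agree by computation.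
    (length-filter-map (avoids? (false ∷ u)) (avoids? u) (false ∷_) (λ _ → refl) ws)
    (length-filter-map (avoids? (false ∷ u)) (avoids? (false ∷ u)) (true ∷_) (λ _ → refl) ws)
  split true = trans (+-comm (length (filter (avoids? (true ∷ u)) (map (false ∷_) ws))) _) (cong₂ _+_
    (length-filter-map (avoids? (true ∷ u)) (avoids? u) (true ∷_) (λ _ → refl) ws)
    (length-filter-map (avoids? (true ∷ u)) (avoids? (true ∷ u)) (false ∷_) (λ _ → refl) ws))

-- The letter `c` does not enter the recurrence, so both counts obey the same one.
length-avoiding : ∀ n u v → length u ≡ length v → length (avoiding u n) ≡ length (avoiding v n)
length-avoiding n [] [] _ = refl
length-avoiding zero (c ∷ u) (d ∷ v) _ = refl
length-avoiding (suc n) (c ∷ u) (d ∷ v) l = begin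
  length (avoiding (c ∷ u) (suc n))                   ≡⟨ length-avoiding-suc c u n ⟩
  length (avoiding u n) + length (avoiding (c ∷ u) n) ≡⟨ cong₂ _+_
    (length-avoiding n u v (suc-injective l)) (length-avoiding n (c ∷ u) (d ∷ v) l) ⟩
  length (avoiding v n) + length (avoiding (d ∷ v) n) ≡⟨ length-avoiding-suc d v n ⟨
  length (avoiding (d ∷ v) (suc n))                   ∎
  where open ≡-Reasoning

-- Representatives of the avoiding circular permutations

Complex : List Bool → Set
Complex w = 2 < runs w

complex? : ∀ w → Dec (Complex w)
complex? w = 2 <? runs w

simple : ℕ → List (List Bool)
simple n = filter (λ w → ¬? (complex? w)) (words n)

complexAvoiding : List Bool → ℕ → List (List Bool)
complexAvoiding u n = filter complex? (avoiding u n)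

-- The complement of `P` lies inside `Q`, so it can be counted without filtering by `Q`.
length-filter-split : ∀ {A : Set} {P Q : A → Set} (P? : ∀ x → Dec (P x)) (Q? : ∀ x → Dec (Q x)) →
  (∀ {x} → ¬ P x → Q x) → ∀ xs →
  length (filter (λ x → ¬? (P? x)) xs) + length (filter P? (filter Q? xs)) ≡ length (filter Q? xs)
length-filter-split P? Q? ¬P⇒Q [] = refl
length-filter-split P? Q? ¬P⇒Q (x ∷ xs) with Q? x | length-filter-split P? Q? ¬P⇒Q xs
... | yes _ | ih with P? x
...   | yes _ = trans (+-suc _ _) (cong suc ih)
...   | no  _ = cong suc ih
length-filter-split P? Q? ¬P⇒Q (x ∷ xs) | no ¬q | ih with P? x
...   | yes _ = ih
...   | no ¬p = contradiction (¬P⇒Q ¬p) ¬q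

length-complexAvoiding : ∀ {u} n → Complex u →
  length (simple n) + length (complexAvoiding u n) ≡ length (avoiding u n)
length-complexAvoiding {u} n cu = length-filter-split complex? (avoids? u)
  (λ ¬cw u⊆w → ¬cw (≤-trans cu (runs-⊆ u⊆w))) (words n)

-- Different words with at most two runs can give the same circular permutation, hence `circles` in
-- the first part. Its size stays uncomputed, being independent of `u`.
representatives : List Bool → ℕ → List (List ℕ)
representatives u n = circles (map sigma (simple n)) ++ map sigma (complexAvoiding u n)

sigma-NonEmpty : ∀ w → NonEmpty (sigma w)
sigma-NonEmpty w = subst (0 <_) (sym (Shaped-length (sigma-Shaped w))) (s≤s z≤n)

-- Only one word is assumed to be complex, so this also separates complex words from simple ones.
sigma-↻⇒≡ : ∀ {v w} → Complex w → sigma v ↻ sigma w → v ≡ w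
sigma-↻⇒≡ {v} {w} cw r = Shaped-unique
  (subst (Shaped v) (Shaped-↻⇒≡ cw (sigma-Shaped v) (sigma-Shaped w) r) (sigma-Shaped v))
  (sigma-Shaped w)

AllPairs-map : ∀ {A B : Set} {R : A → A → Set} {S : B → B → Set} (f : A → B) {xs} →
  (∀ {x y} → y ∈ xs → R x y → S (f x) (f y)) → AllPairs R xs → AllPairs S (map f xs)
AllPairs-map f g [] = []
AllPairs-map f g (p ∷ ps) =
  AllP.map⁺ (All.tabulate λ y∈ → g (there y∈) (All.lookup p y∈)) ∷ AllPairs-map f (g ∘ there) ps

complexAvoiding⁻ : ∀ u n {w} → w ∈ complexAvoiding u n → w ∈ words n × ¬ u ⊆ w × Complex w
complexAvoiding⁻ u n w∈ with w∈′ , cw ← ∈-filter⁻ complex? {xs = avoiding u n} w∈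
  with w∈″ , av ← ∈-filter⁻ (avoids? u) {xs = words n} w∈′ = w∈″ , av , cw

representatives-distinct : ∀ u n → PairwiseDistinct (representatives u n)
representatives-distinct u n = AllPairsP.++⁺
  (circles-distinct (AllP.map⁺ (All.tabulate λ {w} _ → sigma-NonEmpty w)))
  (AllPairs-map sigma (λ w∈ v≢w r → v≢w (sigma-↻⇒≡ (complex w∈) r))
    (UniqueP.filter⁺ complex? (UniqueP.filter⁺ (avoids? u) (words-unique n))))
  (All.tabulate λ π∈ → AllP.map⁺ (All.tabulate λ w∈ → cross π∈ w∈))
  where
  complex : ∀ {w} → w ∈ complexAvoiding u n → Complex w
  complex w∈ = proj₂ (proj₂ (complexAvoiding⁻ u n w∈))
  cross : ∀ {π w} → π ∈ circles (map sigma (simple n)) → w ∈ complexAvoiding u n → ¬ π ↻ sigma w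
  cross π∈ w∈ r with v , v∈ , refl ← ∈-map⁻ sigma (∈-circles⁻ π∈)
    with refl ← sigma-↻⇒≡ (complex w∈) r
    = proj₂ (∈-filter⁻ (λ w → ¬? (complex? w)) {xs = words n} v∈) (complex w∈)

avoiders : List Bool → ℕ → List (List ℕ)
avoiders u n = filterᵇ (avoidsAllᵇ (p1342 ∷ sigma u ∷ [])) (perms n)

perms-NonEmpty : ∀ n {π} → π ∈ perms (suc n) → NonEmpty π
perms-NonEmpty n π∈ = subst (0 <_)
  (sym (trans (↭-length (perms⇒↭ (suc n) π∈)) (length-applyDownFrom (1 +_) (suc n)))) (s≤s z≤n)

avoiders⁻ : ∀ u n {π} → π ∈ avoiders u (suc n) →
  π ∈ perms (suc n) × ¬ Contains π p1342 × ¬ Contains π (sigma u)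
avoiders⁻ u n π∈
  with π∈′ , av ← ∈-filter⁻ (T? ∘ avoidsAllᵇ (p1342 ∷ sigma u ∷ [])) {xs = perms (suc n)} π∈ =
  π∈′ , avoids⇒¬Contains p1342 (sigma u) (perms-NonEmpty n π∈′) av

sigma-avoider : ∀ u n {w} → Complex u → w ∈ words n → ¬ u ⊆ w → sigma w ∈ avoiders u (suc n)
sigma-avoider u n {w} cu w∈ av =
  ∈-filter⁺ (T? ∘ avoidsAllᵇ (p1342 ∷ sigma u ∷ []))
    (↭⇒perms (suc n) (subst (λ n → sigma w ↭ interval 1 (suc n)) (∈-words⁻ n w∈) (sigma-↭ w)))
    (¬Contains⇒avoids p1342 (sigma u) (Shaped-avoids-1342 (sigma-Shaped w))
      (λ k → av (Contains⇒subword cu (sigma-Shaped u) (sigma-Shaped w) k)))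

avoiders⇒representatives : ∀ u n {π} → π ∈ avoiders u (suc n) → Any (π ↻_) (representatives u n)
avoiders⇒representatives u n π∈
  with π∈′ , av , avu ← avoiders⁻ u n π∈
  with w , refl , π↻σ ← avoids-1342⇒sigma n (perms⇒↭ (suc n) π∈′) av
  with complex? w
... | yes cw = AnyP.++⁺ʳ _
  (lose (∈-map⁺ sigma (∈-filter⁺ complex? (∈-filter⁺ (avoids? u) (∈-words⁺ w) u⊈w) cw)) π↻σ)
  where
  u⊈w : ¬ u ⊆ w
  u⊈w u⊆w = avu (Contains-↻ (↻-sym π↻σ) (subword⇒Contains (sigma-Shaped u) (sigma-Shaped w) u⊆w))
... | no ¬cw = AnyP.++⁺ˡ (Any.map (↻-trans π↻σ)
  (circles-cover (∈-map⁺ sigma (∈-filter⁺ (λ w → ¬? (complex? w)) (∈-words⁺ w) ¬cw))))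

representatives⇒avoiders : ∀ u n {π} → Complex u → π ∈ representatives u n → π ∈ avoiders u (suc n)
representatives⇒avoiders u n cu π∈ with ∈-++⁻ (circles (map sigma (simple n))) π∈
... | inj₁ π∈′ with w , w∈ , refl ← ∈-map⁻ sigma (∈-circles⁻ π∈′)
  with w∈′ , ¬cw ← ∈-filter⁻ (λ w → ¬? (complex? w)) {xs = words n} w∈
  = sigma-avoider u n cu w∈′ (λ u⊆w → ¬cw (≤-trans cu (runs-⊆ u⊆w)))
... | inj₂ π∈′ with w , w∈ , refl ← ∈-map⁻ sigma π∈′
  with w∈′ , av , _ ← complexAvoiding⁻ u n w∈
  = sigma-avoider u n cu w∈′ av

-- Both lists meet the same rotation classes, each class once, so `classes-≤` applies in both
-- directions.
numAv-representatives : ∀ u n → Complex u →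
  numAv (suc n) (p1342 ∷ sigma u ∷ []) ≡ length (representatives u n)
numAv-representatives u n cu = ≤-antisym
  (classes-≤ (circles-distinct (All.tabulate λ π∈ → perms-NonEmpty n (proj₁ (avoiders⁻ u n π∈))))
    (avoiders⇒representatives u n ∘ ∈-circles⁻))
  (classes-≤ (representatives-distinct u n)
    (circles-cover ∘ representatives⇒avoiders u n cu))

-- Adding the number of simple words turns the count of complex avoiding words into that of all
-- avoiding words, without any subtraction.
numAv-simple : ∀ u n → Complex u → numAv (suc n) (p1342 ∷ sigma u ∷ []) + length (simple n) ≡
  length (circles (map sigma (simple n))) + length (avoiding u n)
numAv-simple u n cu = begin
  numAv (suc n) (p1342 ∷ sigma u ∷ []) + s ≡⟨ cong (_+ s) (numAv-representatives u n cu) ⟩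
  length (representatives u n) + s         ≡⟨ cong (_+ s) (length-++ (circles (map sigma (simple n)))) ⟩
  (c + length (map sigma (complexAvoiding u n))) + s
    ≡⟨ cong (λ k → c + k + s) (length-map sigma (complexAvoiding u n)) ⟩
  (c + length (complexAvoiding u n)) + s   ≡⟨ +-assoc c _ s ⟩
  c + (length (complexAvoiding u n) + s)   ≡⟨ cong (c +_) (+-comm _ s) ⟩
  c + (s + length (complexAvoiding u n))   ≡⟨ cong (c +_) (length-complexAvoiding n cu) ⟩
  c + length (avoiding u n)                ∎
  where
  open ≡-Reasoning
  s = length (simple n)
  c = length (circles (map sigma (simple n)))

theorem3p15 : (k : ℕ) → 1 ≤ k → (w w' : Vec Bool k) →
    2 < runs (toList w) → 2 < runs (toList w') →
    WilfEquiv (p1342 ∷ sigma (toList w) ∷ []) (p1342 ∷ sigma (toList w') ∷ [])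
theorem3p15 k _ w w' cw cw' (suc n) _ = +-cancelʳ-≡ (length (simple n)) _ _ (begin
  numAv (suc n) (p1342 ∷ sigma (toList w) ∷ []) + length (simple n)
    ≡⟨ numAv-simple (toList w) n cw ⟩
  length (circles (map sigma (simple n))) + length (avoiding (toList w) n)
    -- The last summand is the only one that depends on the word, and only through its length.
    ≡⟨ cong (length (circles (map sigma (simple n))) +_)
        (length-avoiding n (toList w) (toList w') (trans (length-toList w) (sym (length-toList w')))) ⟩
  length (circles (map sigma (simple n))) + length (avoiding (toList w') n)
    ≡⟨ numAv-simple (toList w') n cw' ⟨
  numAv (suc n) (p1342 ∷ sigma (toList w') ∷ []) + length (simple n) ∎)
  where open ≡-Reasoning
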